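{- SP, BTI, WF, PCI, IRE and RPI hold for the LTSIs of CCSKP (CCSK with proof labels) and CCSK.
   Context: CCSK processes: $X ::= \mathbf{0} \mid \alpha.X \mid X\backslash\lambda \mid X+Y \mid X \mid Y \mid \alpha[k].X$, where $\alpha$ ranges over names, co-names and $\tau$, $\lambda$ over non-$\tau$ labels, and $k$ over keys; $\mathrm{keys}(X)$ is the set of keys in $X$, and $X$ is standard if $\mathrm{keys}(X)=\emptyset$. Only reachable processes (reachable by a path from a standard process) are considered. CCSKP forward rules (with proof keyed labels $\theta$ built from strings over $\mid_L,\mid_R,+_L,+_R$, actions $\alpha[k]$ and synchronisation pairs $\langle\upsilon_1\lambda[k],\upsilon_2\overline\lambda[k]\rangle$, each having a key): act: $\alpha.X \to^{\alpha[k]} \alpha[k].X$ if $X$ standard; pre: $\alpha[k].X \to^{\theta} \alpha[k].X'$ if $X\to^\theta X'$ and the key of $\theta$ is not $k$; res: $X\backslash a \to^\theta X'\backslash a$ if $X\to^\theta X'$ and the action of $\theta$ is not $a$ or $\overline a$; par: $X\mid Y \to^{\mid_L\theta} X'\mid Y$ if $X\to^\theta X'$ and the key of $\theta$ is not in $\mathrm{keys}(Y)$ (symmetrically on the right); syn: $X\mid Y \to^{\langle\upsilon_L\lambda[k],\upsilon_R\overline\lambda[k]\rangle} X'\mid Y'$ if $X\to^{\upsilon_L\lambda[k]}X'$ and $Y\to^{\upsilon_R\overline\lambda[k]}Y'$; sum: $X+Y\to^{+_L\theta}X'+Y$ if $X\to^\theta X'$ and $Y$ standard (symmetrically on the right).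 Backward transitions are the inverses of forward ones. CCSK has the same rules with labels $\alpha[k]$ only (proof part erased); CCSK and CCSKP transitions are in bijection. Two transitions are connected if there is a path from the source of one to the target of the other. The independence relation: two transitions are independent iff they are connected and their proof keyed labels (for CCSK, those of the corresponding CCSKP transitions) are independent, where label independence is the least relation with: $+_d\theta$ independent of $+_d\theta'$ if $\theta$ independent of $\theta'$; $\mid_d\theta$ independent of $\mid_d\theta'$ if $\theta$ independent of $\theta'$; $\mid_d\theta$ independent of $\mid_{\overline d}\theta'$ if their keys differ; $\mid_d\theta$ independent of $\langle\theta_L,\theta_R\rangle$ (and symmetrically) if $\theta$ independent of $\theta_d$; $\langle\theta_1,\theta_2\rangle$ independent of $\langle\theta'_1,\theta'_2\rangle$ if $\theta_1$ independent of $\theta'_1$ and $\theta_2$ independent of $\theta'_2$. An LTSI is a combined forward/backward LTS with an irreflexive symmetric independence relation on transitions. Axioms: SP (square property): coinitial independent $t:P\to^\alpha Q$, $u:P\to^\beta R$ admit cofinal $u':Q\to^\beta S$, $t':R\to^\alpha S$. BTI: distinct coinitial backward transitions are independent. WF: no infinite backward computation. PCI: in such a square with $t$ independent of $u$, $u'$ is independent of the inverse of $t$. IRE: if $t\sim t'$ and $t'$ independent of $u$ then $t$ independent of $u$, where $\sim$ (event equivalence) is the least equivalence relating opposite sides $t,t'$ of squares built from independent coinitial $t,u$. RPI: if $t$ independent of $t'$ then the inverse of $t$ is independent of $t'$. -}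

module Defs where

open import Data.Empty using (⊥-elim)
open import Data.List.Base using (List; []; _∷_; _++_; foldr)
open import Data.List.Membership.Propositional using (_∈_; _∉_)
open import Data.List.Membership.Propositional.Properties using (∈-++⁺ˡ; ∈-++⁺ʳ; ∈-++⁻)
open import Data.List.Relation.Unary.Any using (here; there)
open import Data.Nat.Base using (ℕ; suc)
open import Data.Product.Base using (Σ-syntax; ∃; ∃-syntax; ∃₂; _×_; _,_; proj₁; proj₂)
open import Data.Sum.Base using (inj₁; inj₂)
open import Relation.Binary.Construct.Closure.ReflexiveTransitive using (Star; ε; _◅_; _◅◅_; reverse)
open import Relation.Binary.PropositionalEquality using (_≡_; _≢_; refl; sym; trans; cong; subst)
open import Relation.Nullary using (¬_)

data Direction : Set where
  fwd bwd : Direction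

flip-dir : Direction → Direction
flip-dir fwd = bwd
flip-dir bwd = fwd

-- A forward LTS with its initial (for CCSK: standard) states, and the
-- combined forward/backward LTS it generates.
record LTS : Set₁ where
  field
    State   : Set
    Lab     : Set
    Initial : State → Set
    Forward : State → Lab → State → Set

  Step : State → Direction × Lab → State → Set
  Step P (fwd , a) Q = Forward P a Q
  Step P (bwd , a) Q = Forward Q a P

  Path : State → State → Set
  Path = Star (λ P Q → ∃[ α ] Step P α Q)

  Reachable : State → Set
  Reachable P = ∃[ P₀ ] (Initial P₀ × Path P₀ P)

  -- The processes are the reachable states only.  A target of a step from a
  -- reachable state is reachable, so one condition, on the source, suffices;
  -- likewise a Path from a reachable state visits reachable states only.
  record Transition : Set where
    eta-equality
    constructor transition
    field
      src       : State
      lab       : Direction × Lab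
      tgt       : State
      reachable : Reachable src
      step      : Step src lab tgt

  open Transition public

  dir : Transition → Direction
  dir t = proj₁ (lab t)

  label : Transition → Lab
  label t = proj₂ (lab t)

  -- A transition is determined by its source, label and target; the evidence
  -- for `reachable` and `step` does not count.
  _≐_ : Transition → Transition → Set
  t ≐ u = (src t ≡ src u) × (lab t ≡ lab u) × (tgt t ≡ tgt u)

  Step-flip : ∀ {P Q} d {a} → Step P (d , a) Q → Step Q (flip-dir d , a) P
  Step-flip fwd s = s
  Step-flip bwd s = s

  inverse : Transition → Transition
  inverse (transition P (d , a) Q (P₀ , i , p) s) =
    transition Q (flip-dir d , a) P (P₀ , i , p ◅◅ (((d , a) , s) ◅ ε)) (Step-flip d s)

  Connected : Transition → Transition → Set
  Connected t u = Path (src t) (tgt u)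

  Path-sym : ∀ {P Q} → Path P Q → Path Q P
  Path-sym = reverse (λ { ((d , a) , s) → (flip-dir d , a) , Step-flip d s })

  Connected-sym : ∀ {t u} → Connected t u → Connected u t
  Connected-sym {t} {u} p =
    ((lab u , step u) ◅ Path-sym p) ◅◅ ((lab t , step t) ◅ ε)

  Connected-resp : ∀ {t t′ u u′} → t ≐ t′ → u ≐ u′ → Connected t u → Connected t′ u′
  Connected-resp (refl , _) (_ , _ , refl) p = p

record LTSI : Set₁ where
  field
    lts : LTS
  open LTS lts public
  infix 4 _ι_
  field
    _ι_      : Transition → Transition → Set
    ι-resp   : ∀ {t t′ u u′} → t ≐ t′ → u ≐ u′ → t ι u → t′ ι u′
    ι-irrefl : ∀ {t} → ¬ (t ι t)
    ι-sym    : ∀ {t u} → t ι u → u ι t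

--        t
--     P ----> Q
--   u |       | u′
--     v       v
--     R ----> S
--        t′
module _ (L : LTSI) where
  open LTSI L

  record Square (t u u′ t′ : Transition) : Set where
    field
      coinitial  : src t ≡ src u
      t-then-u′  : tgt t ≡ src u′
      u-then-t′  : tgt u ≡ src t′
      cofinal    : tgt u′ ≡ tgt t′
      same-lab-t : lab t′ ≡ lab t
      same-lab-u : lab u′ ≡ lab u

  data EventEquiv : Transition → Transition → Set where
    square : ∀ {t u u′ t′} → Square t u u′ t′ → t ι u → EventEquiv t t′
    ~-refl : ∀ {t t′} → t ≐ t′ → EventEquiv t t′
    ~-sym  : ∀ {t t′} → EventEquiv t t′ → EventEquiv t′ t
    ~-trans : ∀ {t t′ t″} → EventEquiv t t′ → EventEquiv t′ t″ → EventEquiv t t″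

  SP : Set
  SP = ∀ t u → src t ≡ src u → t ι u → ∃₂ λ u′ t′ → Square t u u′ t′

  BTI : Set
  BTI = ∀ t u → dir t ≡ bwd → dir u ≡ bwd → src t ≡ src u → ¬ (t ≐ u) → t ι u

  WF : Set
  WF = ¬ (Σ[ s ∈ (ℕ → Transition) ] (∀ n → dir (s n) ≡ bwd × tgt (s n) ≡ src (s (suc n))))

  PCI : Set
  PCI = ∀ t u u′ t′ → Square t u u′ t′ → t ι u → u′ ι inverse t

  IRE : Set
  IRE = ∀ t t′ u → EventEquiv t t′ → t′ ι u → t ι u

  RPI : Set
  RPI = ∀ t t′ → t ι t′ → inverse t ι t′

module Calculus (Name Key : Set) where

  data Label : Set where
    name   : Name → Label
    coname : Name → Label

  co : Label → Label
  co (name a)   = coname a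
  co (coname a) = name a

  data Act : Set where
    vis : Label → Act
    τ   : Act

  infixr 8 _∙_ _[_]∙_
  infixl 7 _∖_
  infixl 6 _∣_
  infixl 5 _⊕_

  data Process : Set where
    𝟎      : Process
    _∙_    : Act → Process → Process
    _∖_    : Process → Label → Process
    _⊕_    : Process → Process → Process
    _∣_    : Process → Process → Process
    _[_]∙_ : Act → Key → Process → Process

  keys : Process → List Key
  keys 𝟎            = []
  keys (α ∙ X)      = keys X
  keys (X ∖ l)      = keys X
  keys (X ⊕ Y)      = keys X ++ keys Y
  keys (X ∣ Y)      = keys X ++ keys Y
  keys (α [ k ]∙ X) = k ∷ keys X

  Standard : Process → Set
  Standard X = keys X ≡ []

  data Side : Set where
    L R : Side

  data Symbol : Set where
    ∣ₛ +ₛ : Side → Symbol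

  -- θ ::= υ α[k]  |  υ ⟨ υL λ[k] , υR λ̄[k] ⟩  with υ a string of symbols;
  -- the pair is written  pair υL υR λ k.
  infixr 8 _⊳_ _⊳*_
  data ProofLabel : Set where
    act  : Act → Key → ProofLabel
    pair : List Symbol → List Symbol → Label → Key → ProofLabel
    _⊳_  : Symbol → ProofLabel → ProofLabel

  _⊳*_ : List Symbol → ProofLabel → ProofLabel
  υ ⊳* θ = foldr _⊳_ θ υ

  component : Side → List Symbol → List Symbol → Label → Key → ProofLabel
  component L υL υR l k = υL ⊳* act (vis l) k
  component R υL υR l k = υR ⊳* act (vis (co l)) k

  action : ProofLabel → Act
  action (act α k)        = α
  action (pair υL υR l k) = τ
  action (s ⊳ θ)          = action θ

  key : ProofLabel → Key
  key (act α k)        = k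
  key (pair υL υR l k) = k
  key (s ⊳ θ)          = key θ

  infix 4 _—[_]→ₚ_
  data _—[_]→ₚ_ : Process → ProofLabel → Process → Set where
    act  : ∀ {α X k} → Standard X → α ∙ X —[ act α k ]→ₚ α [ k ]∙ X
    pre  : ∀ {α X X′ k θ} → X —[ θ ]→ₚ X′ → key θ ≢ k →
           α [ k ]∙ X —[ θ ]→ₚ α [ k ]∙ X′
    res  : ∀ {X X′ l θ} → X —[ θ ]→ₚ X′ → action θ ≢ vis l → action θ ≢ vis (co l) →
           X ∖ l —[ θ ]→ₚ X′ ∖ l
    parL : ∀ {X X′ Y θ} → X —[ θ ]→ₚ X′ → key θ ∉ keys Y →
           X ∣ Y —[ ∣ₛ L ⊳ θ ]→ₚ X′ ∣ Y
    parR : ∀ {X Y Y′ θ} → Y —[ θ ]→ₚ Y′ → key θ ∉ keys X →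
           X ∣ Y —[ ∣ₛ R ⊳ θ ]→ₚ X ∣ Y′
    syn  : ∀ {X X′ Y Y′ υL υR l k} →
           X —[ υL ⊳* act (vis l) k ]→ₚ X′ → Y —[ υR ⊳* act (vis (co l)) k ]→ₚ Y′ →
           X ∣ Y —[ pair υL υR l k ]→ₚ X′ ∣ Y′
    sumL : ∀ {X X′ Y θ} → X —[ θ ]→ₚ X′ → Standard Y →
           X ⊕ Y —[ +ₛ L ⊳ θ ]→ₚ X′ ⊕ Y
    sumR : ∀ {X Y Y′ θ} → Y —[ θ ]→ₚ Y′ → Standard X →
           X ⊕ Y —[ +ₛ R ⊳ θ ]→ₚ X ⊕ Y′

  infix 4 _—[_]→_
  data _—[_]→_ : Process → Act × Key → Process → Set where
    act  : ∀ {α X k} → Standard X → α ∙ X —[ α , k ]→ α [ k ]∙ X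
    pre  : ∀ {α β X X′ k m} → X —[ β , m ]→ X′ → m ≢ k →
           α [ k ]∙ X —[ β , m ]→ α [ k ]∙ X′
    res  : ∀ {α X X′ l k} → X —[ α , k ]→ X′ → α ≢ vis l → α ≢ vis (co l) →
           X ∖ l —[ α , k ]→ X′ ∖ l
    parL : ∀ {α X X′ Y k} → X —[ α , k ]→ X′ → k ∉ keys Y →
           X ∣ Y —[ α , k ]→ X′ ∣ Y
    parR : ∀ {α X Y Y′ k} → Y —[ α , k ]→ Y′ → k ∉ keys X →
           X ∣ Y —[ α , k ]→ X ∣ Y′
    syn  : ∀ {X X′ Y Y′ l k} → X —[ vis l , k ]→ X′ → Y —[ vis (co l) , k ]→ Y′ →
           X ∣ Y —[ τ , k ]→ X′ ∣ Y′
    sumL : ∀ {α X X′ Y k} → X —[ α , k ]→ X′ → Standard Y →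
           X ⊕ Y —[ α , k ]→ X′ ⊕ Y
    sumR : ∀ {α X Y Y′ k} → Y —[ α , k ]→ Y′ → Standard X →
           X ⊕ Y —[ α , k ]→ X ⊕ Y′

  infix 4 _⌣_
  data _⌣_ : ProofLabel → ProofLabel → Set where
    sum       : ∀ {d θ θ′} → θ ⌣ θ′ → +ₛ d ⊳ θ ⌣ +ₛ d ⊳ θ′
    par-same  : ∀ {d θ θ′} → θ ⌣ θ′ → ∣ₛ d ⊳ θ ⌣ ∣ₛ d ⊳ θ′
    par-opp   : ∀ {d d′ θ θ′} → d ≢ d′ → key θ ≢ key θ′ → ∣ₛ d ⊳ θ ⌣ ∣ₛ d′ ⊳ θ′
    par-pair  : ∀ {d θ υL υR l k} → θ ⌣ component d υL υR l k →
                ∣ₛ d ⊳ θ ⌣ pair υL υR l k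
    pair-par  : ∀ {d θ υL υR l k} → component d υL υR l k ⌣ θ →
                pair υL υR l k ⌣ ∣ₛ d ⊳ θ
    pair-pair : ∀ {υL υR l k υL′ υR′ l′ k′} →
                component L υL υR l k ⌣ component L υL′ υR′ l′ k′ →
                component R υL υR l k ⌣ component R υL′ υR′ l′ k′ →
                pair υL υR l k ⌣ pair υL′ υR′ l′ k′

  ⌣-sym : ∀ {θ θ′} → θ ⌣ θ′ → θ′ ⌣ θ
  ⌣-sym (sum i)         = sum (⌣-sym i)
  ⌣-sym (par-same i)    = par-same (⌣-sym i)
  ⌣-sym (par-opp d k)   = par-opp (λ e → d (sym e)) (λ e → k (sym e))
  ⌣-sym (par-pair i)    = pair-par (⌣-sym i)
  ⌣-sym (pair-par i)    = par-pair (⌣-sym i)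
  ⌣-sym (pair-pair i j) = pair-pair (⌣-sym i) (⌣-sym j)

  key-⊳* : ∀ υ {α k} → key (υ ⊳* act α k) ≡ k
  key-⊳* []      = refl
  key-⊳* (s ∷ υ) = key-⊳* υ

  key-component : ∀ d {υL υR l k} → key (component d υL υR l k) ≡ k
  key-component L {υL}      = key-⊳* υL
  key-component R {υR = υR} = key-⊳* υR

  ⌣⇒key≢ : ∀ {θ θ′} → θ ⌣ θ′ → key θ ≢ key θ′
  ⌣⇒key≢ (sum i)          = ⌣⇒key≢ i
  ⌣⇒key≢ (par-same i)     = ⌣⇒key≢ i
  ⌣⇒key≢ (par-opp _ k≢)   = k≢
  ⌣⇒key≢ (par-pair {d} i) e = ⌣⇒key≢ i (trans e (sym (key-component d)))
  ⌣⇒key≢ (pair-par {d} i) e = ⌣⇒key≢ i (trans (key-component d) e)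
  ⌣⇒key≢ (pair-pair {υL} {υL′ = υL′} i _) e =
    ⌣⇒key≢ i (trans (key-⊳* υL) (trans e (sym (key-⊳* υL′))))

  key-fresh : ∀ {X θ X′} → X —[ θ ]→ₚ X′ → key θ ∉ keys X
  key-fresh (act std) k∈ with () ← subst (_ ∈_) std k∈
  key-fresh (pre t k≢) (here e)   = k≢ e
  key-fresh (pre t k≢) (there k∈) = key-fresh t k∈
  key-fresh (res t _ _) = key-fresh t
  key-fresh {X ∣ Y} (parL t k∉) k∈ with ∈-++⁻ (keys X) k∈
  ... | inj₁ x = key-fresh t x
  ... | inj₂ y = k∉ y
  key-fresh {X ∣ Y} (parR t k∉) k∈ with ∈-++⁻ (keys X) k∈
  ... | inj₁ x = k∉ x
  ... | inj₂ y = key-fresh t y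
  key-fresh {X ∣ Y} (syn {υL = υL} {υR} t u) k∈ with ∈-++⁻ (keys X) k∈
  ... | inj₁ x = key-fresh t (subst (_∈ keys X) (sym (key-⊳* υL)) x)
  ... | inj₂ y = key-fresh u (subst (_∈ keys Y) (sym (key-⊳* υR)) y)
  key-fresh {X ⊕ Y} (sumL t std) k∈ with ∈-++⁻ (keys X) k∈
  ... | inj₁ x = key-fresh t x
  ... | inj₂ y with () ← subst (_ ∈_) std y
  key-fresh {X ⊕ Y} (sumR t std) k∈ with ∈-++⁻ (keys X) k∈
  ... | inj₂ y = key-fresh t y
  ... | inj₁ x with () ← subst (_ ∈_) std x

  key-added : ∀ {X θ X′} → X —[ θ ]→ₚ X′ → key θ ∈ keys X′
  key-added (act _)     = here refl
  key-added (pre t _)   = there (key-added t)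
  key-added (res t _ _) = key-added t
  key-added (parL t _)  = ∈-++⁺ˡ (key-added t)
  key-added {X ∣ _} (parR t _) = ∈-++⁺ʳ (keys X) (key-added t)
  key-added (syn {X′ = X′} {υL = υL} t _) =
    ∈-++⁺ˡ (subst (_∈ keys X′) (key-⊳* υL) (key-added t))
  key-added (sumL t _)  = ∈-++⁺ˡ (key-added t)
  key-added {X ⊕ _} (sumR t _) = ∈-++⁺ʳ (keys X) (key-added t)

  no-loop : ∀ {X θ} → ¬ (X —[ θ ]→ₚ X)
  no-loop t = key-fresh t (key-added t)

  ⊳-injective : ∀ {s s′ θ θ′} → s ⊳ θ ≡ s′ ⊳ θ′ → s ≡ s′ × θ ≡ θ′
  ⊳-injective refl = refl , refl

  ⊳*-injective : ∀ υ υ′ {α α′ k k′} → υ ⊳* act α k ≡ υ′ ⊳* act α′ k′ →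
                 υ ≡ υ′ × α ≡ α′ × k ≡ k′
  ⊳*-injective []      []        refl = refl , refl , refl
  ⊳*-injective (s ∷ υ) (s′ ∷ υ′) e
    with refl , e′ ← ⊳-injective e
    with refl , p ← ⊳*-injective υ υ′ e′ = refl , p

  -- Together with `lift`: every CCSK transition has exactly one corresponding
  -- CCSKP transition.
  label-unique : ∀ {X θ θ′ X′} → X —[ θ ]→ₚ X′ → X —[ θ′ ]→ₚ X′ → θ ≡ θ′
  label-unique (act _)     (act _)     = refl
  label-unique (pre t _)   (pre u _)   = label-unique t u
  label-unique (res t _ _) (res u _ _) = label-unique t u
  label-unique (parL t _)  (parL u _)  = cong (_ ⊳_) (label-unique t u)
  label-unique (parL t _)  (parR u _)  = ⊥-elim (no-loop t)
  label-unique (parL t _)  (syn _ u)   = ⊥-elim (no-loop u)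
  label-unique (parR t _)  (parL u _)  = ⊥-elim (no-loop t)
  label-unique (parR t _)  (parR u _)  = cong (_ ⊳_) (label-unique t u)
  label-unique (parR t _)  (syn u _)   = ⊥-elim (no-loop u)
  label-unique (syn _ t)   (parL u _)  = ⊥-elim (no-loop t)
  label-unique (syn t _)   (parR u _)  = ⊥-elim (no-loop t)
  label-unique (syn {υL = υL} {υR} t u) (syn {υL = υL′} {υR′} t′ u′)
    with refl , refl , refl ← ⊳*-injective υL υL′ (label-unique t t′)
       | refl , _ ← ⊳*-injective υR υR′ (label-unique u u′) = refl
  label-unique (sumL t _)  (sumL u _)  = cong (_ ⊳_) (label-unique t u)
  label-unique (sumL t _)  (sumR u _)  = ⊥-elim (no-loop t)
  label-unique (sumR t _)  (sumL u _)  = ⊥-elim (no-loop t)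
  label-unique (sumR t _)  (sumR u _)  = cong (_ ⊳_) (label-unique t u)

  visible-form : ∀ θ {l} → action θ ≡ vis l → ∃[ υ ] θ ≡ υ ⊳* act (vis l) (key θ)
  visible-form (act _ _) refl = [] , refl
  visible-form (s ⊳ θ)   e with υ , e′ ← visible-form θ e = s ∷ υ , cong (s ⊳_) e′

  lift : ∀ {X α k X′} → X —[ α , k ]→ X′ →
         ∃[ θ ] (X —[ θ ]→ₚ X′ × action θ ≡ α × key θ ≡ k)
  lift (act std) = _ , act std , refl , refl
  lift (pre t k≢) with _ , t′ , refl , refl ← lift t = _ , pre t′ k≢ , refl , refl
  lift (res t p q) with _ , t′ , refl , refl ← lift t = _ , res t′ p q , refl , refl
  lift (parL t k∉) with _ , t′ , refl , refl ← lift t = _ , parL t′ k∉ , refl , refl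
  lift (parR t k∉) with _ , t′ , refl , refl ← lift t = _ , parR t′ k∉ , refl , refl
  lift (syn {l = l} t u) with θ , t′ , a , refl ← lift t | θ′ , u′ , b , e ← lift u
    with υL , p ← visible-form θ a | υR , q ← visible-form θ′ b =
    pair υL υR l _
      , syn {υL = υL} {υR} {l}
            (subst (λ θ → _ —[ θ ]→ₚ _) p t′)
            (subst (λ θ → _ —[ θ ]→ₚ _) (trans q (cong (λ k → υR ⊳* act _ k) e)) u′)
      , refl , refl
  lift (sumL t std) with _ , t′ , refl , refl ← lift t = _ , sumL t′ std , refl , refl
  lift (sumR t std) with _ , t′ , refl , refl ← lift t = _ , sumR t′ std , refl , refl

  CCSKP-LTS : LTS
  CCSKP-LTS = record
    { State = Process ; Lab = ProofLabel ; Initial = Standard ; Forward = _—[_]→ₚ_ }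

  CCSK-LTS : LTS
  CCSK-LTS = record
    { State = Process ; Lab = Act × Key ; Initial = Standard ; Forward = _—[_]→_ }

  private
    module P = LTS CCSKP-LTS
    module K = LTS CCSK-LTS

  CCSKP : LTSI
  CCSKP = record
    { lts      = CCSKP-LTS
    ; _ι_      = λ t u → P.Connected t u × P.label t ⌣ P.label u
    ; ι-resp   = λ { {t} {t′} {u} {u′} p@(_ , refl , _) q@(_ , refl , _) (c , i) →
                     P.Connected-resp {t} {t′} {u} {u′} p q c , i }
    ; ι-irrefl = λ { (_ , i) → ⌣⇒key≢ i refl }
    ; ι-sym    = λ { {t} {u} (c , i) → P.Connected-sym {t} {u} c , ⌣-sym i }
    }

  -- θ labels the CCSKP transition corresponding to t.
  HasProofLabel : K.Transition → ProofLabel → Set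
  HasProofLabel t θ =
    P.Step (K.src t) (K.dir t , θ) (K.tgt t) × (action θ , key θ) ≡ K.label t

  HasProofLabel-unique : ∀ t {θ θ′} → HasProofLabel t θ → HasProofLabel t θ′ → θ ≡ θ′
  HasProofLabel-unique (K.transition _ (fwd , _) _ _ _) (s , _) (s′ , _) = label-unique s s′
  HasProofLabel-unique (K.transition _ (bwd , _) _ _ _) (s , _) (s′ , _) = label-unique s s′

  CCSK : LTSI
  CCSK = record
    { lts      = CCSK-LTS
    ; _ι_      = λ t u → K.Connected t u ×
                   ∃₂ λ θ θ′ → HasProofLabel t θ × HasProofLabel u θ′ × θ ⌣ θ′
    ; ι-resp   = λ { {t} {t′} {u} {u′} p@(refl , refl , refl) q@(refl , refl , refl) (c , i) →
                     K.Connected-resp {t} {t′} {u} {u′} p q c , i }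
    ; ι-irrefl = λ { {t} (_ , θ , θ′ , h , h′ , i) →
                     ⌣⇒key≢ i (cong key (HasProofLabel-unique t h h′)) }
    ; ι-sym    = λ { {t} {u} (c , θ , θ′ , h , h′ , i) →
                     K.Connected-sym {t} {u} c , θ′ , θ , h′ , h , ⌣-sym i }
    }

{-# OPTIONS --safe #-}
-- Two facts about forward steps carry everything.  First, a backward step from
-- a given process is determined by its key, and two backward steps from it with
-- different keys have independent proof labels.  Second, independent coinitial
-- steps can be completed to a square, whatever their directions.  Together they
-- show that opposite sides of a square with equal keys have equal proof labels,
-- which is what transfers PCI and IRE to CCSK, where a square only records the
-- erased labels.  Otherwise the axioms hold because independence of connected
-- transitions depends on their proof labels alone.
module Submission where

open import Data.Empty using (⊥; ⊥-elim)
open import Data.List.Base using ([]; _∷_; length)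
open import Data.List.Membership.Propositional using (_∈_; _∉_)
open import Data.List.Membership.Propositional.Properties using (∈-++⁺ˡ; ∈-++⁺ʳ; ∈-++⁻)
open import Data.List.Properties using (length-++)
open import Data.List.Relation.Unary.Any using (here; there)
open import Data.Nat.Base using (ℕ; suc; _<_; s≤s)
open import Data.Nat.Induction using (<-wellFounded)
open import Data.Nat.Properties using (n<1+n; +-mono-<; +-monoˡ-<; +-monoʳ-<)
open import Data.Product.Base using (∃-syntax; ∃₂; _×_; _,_; proj₁; proj₂)
open import Data.Sum.Base using (inj₁; inj₂)
open import Induction.WellFounded using (Acc; acc)
open import Relation.Binary.Construct.Closure.ReflexiveTransitive using (ε; _◅_; _◅◅_)
open import Relation.Binary.Definitions using (DecidableEquality)
open import Relation.Binary.PropositionalEquality using (_≡_; _≢_; refl; sym; trans; cong; subst; subst₂)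
open import Relation.Nullary using (¬_; yes; no)
open import Defs

-- Infinite descent, connectedness and squares in an arbitrary LTSI

<-no-descent : (f : ℕ → ℕ) → ¬ (∀ n → f (suc n) < f n)
<-no-descent f desc = go 0 (<-wellFounded (f 0))
  where
  go : ∀ n → Acc _<_ (f n) → ⊥
  go n (acc rs) = go (suc n) (rs (desc n))

module _ (I : LTSI) where
  open LTSI I

  measure⇒WF : (μ : State → ℕ) → (∀ {P a Q} → Forward P a Q → μ P < μ Q) → WF I
  measure⇒WF μ μ-mono (s , chain) = <-no-descent (λ n → μ (src (s n))) descent
    where
    backward : ∀ t → dir t ≡ bwd → μ (tgt t) < μ (src t)
    backward (transition _ (bwd , _) _ _ f) refl = μ-mono f

    descent : ∀ n → μ (src (s (suc n))) < μ (src (s n))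
    descent n with d , e ← chain n = subst (λ P → μ P < μ (src (s n))) e (backward (s n) d)

  one-step : ∀ t → Path (src t) (tgt t)
  one-step t = (lab t , step t) ◅ ε

  coinitial⇒Connected : ∀ t u → src t ≡ src u → Connected t u
  coinitial⇒Connected t u refl = one-step u

  inverse-Connected : ∀ t u → Connected t u → Connected (inverse t) u
  inverse-Connected t u p = one-step (inverse t) ◅◅ p

  square-Connected : ∀ {t u u′ t′} → Square I t u u′ t′ → Connected u′ (inverse t)
  square-Connected {t} record { t-then-u′ = refl } = one-step (inverse t)

  -- Serves IRE: `Connected` looks only at the source of its first argument, so a path between the
  -- sources of equivalent transitions carries connectedness over. In the square case this path is
  -- the side `u`.
  EventEquiv-Path : ∀ {t t′} → EventEquiv I t t′ → Path (src t) (src t′)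
  EventEquiv-Path (square {u = u} record { coinitial = refl ; u-then-t′ = refl } _) = one-step u
  EventEquiv-Path (~-refl (refl , _)) = ε
  EventEquiv-Path (~-sym e)           = Path-sym (EventEquiv-Path e)
  EventEquiv-Path (~-trans e e′)      = EventEquiv-Path e ◅◅ EventEquiv-Path e′

  EventEquiv-lab : ∀ {t t′} → EventEquiv I t t′ → lab t ≡ lab t′
  EventEquiv-lab (square sq _)      = sym (Square.same-lab-t sq)
  EventEquiv-lab (~-refl (_ , e , _)) = e
  EventEquiv-lab (~-sym e)          = sym (EventEquiv-lab e)
  EventEquiv-lab (~-trans e e′)     = trans (EventEquiv-lab e) (EventEquiv-lab e′)

  complete-square : ∀ t u → src t ≡ src u →
                    (∃[ S ] (Step (tgt t) (lab u) S × Step (tgt u) (lab t) S)) →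
                    ∃₂ λ u′ t′ → Square I t u u′ t′
  complete-square t u refl (S , f , g) =
      -- `inverse t` starts at `tgt t`, so it already carries the reachability evidence that the new
      -- side requires.
      transition (tgt t) (lab u) S (reachable (inverse t)) f
    , transition (tgt u) (lab t) S (reachable (inverse u)) g
    , record { coinitial = refl ; t-then-u′ = refl ; u-then-t′ = refl
             ; cofinal = refl ; same-lab-t = refl ; same-lab-u = refl }

module _ {Name Key : Set} where
  open Calculus Name Key
  private
    module P = LTS CCSKP-LTS
    module K = LTS CCSK-LTS

  -- Keys along a step

  keys-mono : ∀ {X θ X′ k} → X —[ θ ]→ₚ X′ → k ∈ keys X → k ∈ keys X′
  keys-mono (act _) k∈ = there k∈
  keys-mono (pre t _) (here e)   = here e
  keys-mono (pre t _) (there k∈) = there (keys-mono t k∈)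
  keys-mono (res t _ _) k∈ = keys-mono t k∈
  keys-mono {X ∣ Y} (parL {X′ = X′} t _) k∈ with ∈-++⁻ (keys X) k∈
  ... | inj₁ x = ∈-++⁺ˡ (keys-mono t x)
  ... | inj₂ y = ∈-++⁺ʳ (keys X′) y
  keys-mono {X ∣ Y} (parR t _) k∈ with ∈-++⁻ (keys X) k∈
  ... | inj₁ x = ∈-++⁺ˡ x
  ... | inj₂ y = ∈-++⁺ʳ (keys X) (keys-mono t y)
  keys-mono {X ∣ Y} (syn {X′ = X′} t u) k∈ with ∈-++⁻ (keys X) k∈
  ... | inj₁ x = ∈-++⁺ˡ (keys-mono t x)
  ... | inj₂ y = ∈-++⁺ʳ (keys X′) (keys-mono u y)
  keys-mono {X ⊕ Y} (sumL {X′ = X′} t _) k∈ with ∈-++⁻ (keys X) k∈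
  ... | inj₁ x = ∈-++⁺ˡ (keys-mono t x)
  ... | inj₂ y = ∈-++⁺ʳ (keys X′) y
  keys-mono {X ⊕ Y} (sumR t _) k∈ with ∈-++⁻ (keys X) k∈
  ... | inj₁ x = ∈-++⁺ˡ x
  ... | inj₂ y = ∈-++⁺ʳ (keys X) (keys-mono t y)

  -- With `keys-mono` this fixes which keys occur after a step, so that the freshness conditions of
  -- `parL` and `parR` can be moved across it.
  keys-new : ∀ {X θ X′ k} → X —[ θ ]→ₚ X′ → k ≢ key θ → k ∈ keys X′ → k ∈ keys X
  keys-new (act _) k≢ (here e)   = ⊥-elim (k≢ e)
  keys-new (act _) k≢ (there k∈) = k∈
  keys-new (pre t _) k≢ (here e)   = here e
  keys-new (pre t _) k≢ (there k∈) = there (keys-new t k≢ k∈)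
  keys-new (res t _ _) k≢ k∈ = keys-new t k≢ k∈
  keys-new {X ∣ Y} (parL {X′ = X′} t _) k≢ k∈ with ∈-++⁻ (keys X′) k∈
  ... | inj₁ x = ∈-++⁺ˡ (keys-new t k≢ x)
  ... | inj₂ y = ∈-++⁺ʳ (keys X) y
  keys-new {X ∣ Y} (parR t _) k≢ k∈ with ∈-++⁻ (keys X) k∈
  ... | inj₁ x = ∈-++⁺ˡ x
  ... | inj₂ y = ∈-++⁺ʳ (keys X) (keys-new t k≢ y)
  keys-new {X ∣ Y} (syn {X′ = X′} {υL = υL} {υR} t u) k≢ k∈ with ∈-++⁻ (keys X′) k∈
  ... | inj₁ x = ∈-++⁺ˡ (keys-new t (λ e → k≢ (trans e (key-⊳* υL))) x)
  ... | inj₂ y = ∈-++⁺ʳ (keys X) (keys-new u (λ e → k≢ (trans e (key-⊳* υR))) y)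
  keys-new {X ⊕ Y} (sumL {X′ = X′} t _) k≢ k∈ with ∈-++⁻ (keys X′) k∈
  ... | inj₁ x = ∈-++⁺ˡ (keys-new t k≢ x)
  ... | inj₂ y = ∈-++⁺ʳ (keys X) y
  keys-new {X ⊕ Y} (sumR t _) k≢ k∈ with ∈-++⁻ (keys X) k∈
  ... | inj₁ x = ∈-++⁺ˡ x
  ... | inj₂ y = ∈-++⁺ʳ (keys X) (keys-new t k≢ y)

  fresh-before : ∀ {X θ X′ k} → X —[ θ ]→ₚ X′ → k ∉ keys X′ → k ∉ keys X
  fresh-before t k∉ k∈ = k∉ (keys-mono t k∈)

  -- Unlike `fresh-before`, this direction fails for the key of the step itself.
  fresh-after : ∀ {X θ X′ k} → X —[ θ ]→ₚ X′ → k ≢ key θ → k ∉ keys X → k ∉ keys X′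
  fresh-after t k≢ k∉ k∈ = k∉ (keys-new t k≢ k∈)

  ⌣⇒key≢ʳ : ∀ {θ θ′} → θ ⌣ θ′ → key θ′ ≢ key θ
  ⌣⇒key≢ʳ i e = ⌣⇒key≢ i (sym e)

  fresh-after-syn : ∀ {X X′ k m} υ {α} → X —[ υ ⊳* act α m ]→ₚ X′ →
                    k ≢ m → k ∉ keys X → k ∉ keys X′
  fresh-after-syn υ t k≢ = fresh-after t (λ e → k≢ (trans e (key-⊳* υ)))

  key-added-syn : ∀ {X X′} υ {α k} → X —[ υ ⊳* act α k ]→ₚ X′ → k ∈ keys X′
  key-added-syn υ t = subst (_∈ _) (key-⊳* υ) (key-added t)

  -- Excludes undoing a prefix under which something has happened, and steps taken on both sides of
  -- a sum.
  target-not-standard : ∀ {X θ X′} → X —[ θ ]→ₚ X′ → ¬ Standard X′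
  target-not-standard t std with () ← subst (_ ∈_) std (key-added t)

  -- Keys are counted with multiplicity: a synchronisation lengthens both halves, so the growth is
  -- strict but not always by one.
  length-keys-< : ∀ {X θ X′} → X —[ θ ]→ₚ X′ → length (keys X) < length (keys X′)
  length-keys-< (act _) = n<1+n _
  length-keys-< (pre t _) = s≤s (length-keys-< t)
  length-keys-< (res t _ _) = length-keys-< t
  length-keys-< {X ∣ Y} (parL {X′ = X′} t _) =
    subst₂ _<_ (sym (length-++ (keys X))) (sym (length-++ (keys X′)))
      (+-monoˡ-< _ (length-keys-< t))
  length-keys-< {X ∣ Y} (parR t _) =
    subst₂ _<_ (sym (length-++ (keys X))) (sym (length-++ (keys X)))
      (+-monoʳ-< (length (keys X)) (length-keys-< t))
  length-keys-< {X ∣ Y} (syn {X′ = X′} t u) =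
    subst₂ _<_ (sym (length-++ (keys X))) (sym (length-++ (keys X′)))
      (+-mono-< (length-keys-< t) (length-keys-< u))
  length-keys-< {X ⊕ Y} (sumL {X′ = X′} t _) =
    subst₂ _<_ (sym (length-++ (keys X))) (sym (length-++ (keys X′)))
      (+-monoˡ-< _ (length-keys-< t))
  length-keys-< {X ⊕ Y} (sumR t _) =
    subst₂ _<_ (sym (length-++ (keys X))) (sym (length-++ (keys X)))
      (+-monoʳ-< (length (keys X)) (length-keys-< t))

  -- Squares

  -- Independent steps either act on opposite components, where they commute outright, or share a
  -- component, where induction applies. The freshness condition of each step survives the other
  -- because their keys differ.
  diamond-ff : ∀ {P Q R θ θ′} → P —[ θ ]→ₚ Q → P —[ θ′ ]→ₚ R → θ ⌣ θ′ →
               ∃[ S ] (Q —[ θ′ ]→ₚ S × R —[ θ ]→ₚ S)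
  diamond-ff (act _) (act _) ()
  diamond-ff (pre t p) (pre u q) i with S , u′ , t′ ← diamond-ff t u i =
    _ , pre u′ q , pre t′ p
  diamond-ff (res t p p′) (res u q q′) i with S , u′ , t′ ← diamond-ff t u i =
    _ , res u′ q q′ , res t′ p p′
  diamond-ff (sumL t p) (sumL u q) (sum i) with S , u′ , t′ ← diamond-ff t u i =
    _ , sumL u′ q , sumL t′ p
  diamond-ff (sumR t p) (sumR u q) (sum i) with S , u′ , t′ ← diamond-ff t u i =
    _ , sumR u′ q , sumR t′ p
  diamond-ff (sumL t p) (sumR u q) ()
  diamond-ff (sumR t p) (sumL u q) ()
  -- `par-opp` demands different sides, so it cannot relate two steps on the same side.
  diamond-ff (parL t p) (parL u q) (par-opp d≢ _) = ⊥-elim (d≢ refl)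
  diamond-ff (parL t p) (parL u q) (par-same i) with S , u′ , t′ ← diamond-ff t u i =
    _ , parL u′ q , parL t′ p
  diamond-ff (parR t p) (parR u q) (par-opp d≢ _) = ⊥-elim (d≢ refl)
  diamond-ff (parR t p) (parR u q) (par-same i) with S , u′ , t′ ← diamond-ff t u i =
    _ , parR u′ q , parR t′ p
  diamond-ff (parL t p) (parR u q) i =
    _ , parR u (fresh-after t (⌣⇒key≢ʳ i) q) , parL t (fresh-after u (⌣⇒key≢ i) p)
  diamond-ff (parR t p) (parL u q) i =
    _ , parL u (fresh-after t (⌣⇒key≢ʳ i) q) , parR t (fresh-after u (⌣⇒key≢ i) p)
  -- Only the half `u` of the synchronisation competes with `t`. The half `v` is reused as it
  -- stands, and the key it adds differs from that of `t`.
  diamond-ff (parL t p) (syn {υR = υR} u v) i@(par-pair j) with S , u′ , t′ ← diamond-ff t u j =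
    _ , syn u′ v , parL t′ (fresh-after-syn υR v (⌣⇒key≢ i) p)
  diamond-ff (parR t p) (syn {υL = υL} v u) i@(par-pair j) with S , u′ , t′ ← diamond-ff t u j =
    _ , syn v u′ , parR t′ (fresh-after-syn υL v (⌣⇒key≢ i) p)
  diamond-ff (syn {υR = υR} t v) (parL u q) i@(pair-par j) with S , u′ , t′ ← diamond-ff t u j =
    _ , parL u′ (fresh-after-syn υR v (⌣⇒key≢ʳ i) q) , syn t′ v
  diamond-ff (syn {υL = υL} v t) (parR u q) i@(pair-par j) with S , u′ , t′ ← diamond-ff t u j =
    _ , parR u′ (fresh-after-syn υL v (⌣⇒key≢ʳ i) q) , syn v t′
  diamond-ff (syn t v) (syn u w) (pair-pair i j)
    with S , u′ , t′ ← diamond-ff t u i | T , w′ , v′ ← diamond-ff v w j =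
    _ , syn u′ w′ , syn t′ v′

  -- The freshness conditions are now asymmetric: undoing only removes keys, so that of the forward
  -- step is kept for free, while that of the backward step needs distinct keys.
  diamond-fb : ∀ {P Q R θ θ′} → P —[ θ ]→ₚ Q → R —[ θ′ ]→ₚ P → θ ⌣ θ′ →
               ∃[ S ] (S —[ θ′ ]→ₚ Q × R —[ θ ]→ₚ S)
  -- The forward step lies under the very prefix being undone; no label is independent of an `act`
  -- label.
  diamond-fb (pre t p) (act _) ()
  diamond-fb (pre t p) (pre u q) i with S , u′ , t′ ← diamond-fb t u i =
    _ , pre u′ q , pre t′ p
  diamond-fb (res t p p′) (res u q q′) i with S , u′ , t′ ← diamond-fb t u i =
    _ , res u′ q q′ , res t′ p p′
  diamond-fb (sumL t p) (sumL u q) (sum i) with S , u′ , t′ ← diamond-fb t u i =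
    _ , sumL u′ q , sumL t′ p
  diamond-fb (sumR t p) (sumR u q) (sum i) with S , u′ , t′ ← diamond-fb t u i =
    _ , sumR u′ q , sumR t′ p
  diamond-fb (sumL t p) (sumR u q) ()
  diamond-fb (sumR t p) (sumL u q) ()
  diamond-fb (parL t p) (parL u q) (par-opp d≢ _) = ⊥-elim (d≢ refl)
  diamond-fb (parL t p) (parL u q) (par-same i) with S , u′ , t′ ← diamond-fb t u i =
    _ , parL u′ q , parL t′ p
  diamond-fb (parR t p) (parR u q) (par-opp d≢ _) = ⊥-elim (d≢ refl)
  diamond-fb (parR t p) (parR u q) (par-same i) with S , u′ , t′ ← diamond-fb t u i =
    _ , parR u′ q , parR t′ p
  diamond-fb (parL t p) (parR u q) i =
    _ , parR u (fresh-after t (⌣⇒key≢ʳ i) q) , parL t (fresh-before u p)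
  diamond-fb (parR t p) (parL u q) i =
    _ , parL u (fresh-after t (⌣⇒key≢ʳ i) q) , parR t (fresh-before u p)
  diamond-fb (parL t p) (syn u v) (par-pair j) with S , u′ , t′ ← diamond-fb t u j =
    _ , syn u′ v , parL t′ (fresh-before v p)
  diamond-fb (parR t p) (syn v u) (par-pair j) with S , u′ , t′ ← diamond-fb t u j =
    _ , syn v u′ , parR t′ (fresh-before v p)
  diamond-fb (syn {υR = υR} t v) (parL u q) i@(pair-par j) with S , u′ , t′ ← diamond-fb t u j =
    _ , parL u′ (fresh-after-syn υR v (⌣⇒key≢ʳ i) q) , syn t′ v
  diamond-fb (syn {υL = υL} v t) (parR u q) i@(pair-par j) with S , u′ , t′ ← diamond-fb t u j =
    _ , parR u′ (fresh-after-syn υL v (⌣⇒key≢ʳ i) q) , syn v t′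
  diamond-fb (syn t v) (syn u w) (pair-pair i j)
    with S , u′ , t′ ← diamond-fb t u i | T , w′ , v′ ← diamond-fb v w j =
    _ , syn u′ w′ , syn t′ v′

  -- Undoing never adds keys, so `fresh-before` settles every freshness condition.
  diamond-bb : ∀ {P Q R θ θ′} → Q —[ θ ]→ₚ P → R —[ θ′ ]→ₚ P → θ ⌣ θ′ →
               ∃[ S ] (S —[ θ′ ]→ₚ Q × S —[ θ ]→ₚ R)
  diamond-bb (act _) _ ()
  diamond-bb (pre t p) (act _) ()
  diamond-bb (pre t p) (pre u q) i with S , u′ , t′ ← diamond-bb t u i =
    _ , pre u′ q , pre t′ p
  diamond-bb (res t p p′) (res u q q′) i with S , u′ , t′ ← diamond-bb t u i =
    _ , res u′ q q′ , res t′ p p′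
  diamond-bb (sumL t p) (sumL u q) (sum i) with S , u′ , t′ ← diamond-bb t u i =
    _ , sumL u′ q , sumL t′ p
  diamond-bb (sumR t p) (sumR u q) (sum i) with S , u′ , t′ ← diamond-bb t u i =
    _ , sumR u′ q , sumR t′ p
  diamond-bb (sumL t p) (sumR u q) ()
  diamond-bb (sumR t p) (sumL u q) ()
  diamond-bb (parL t p) (parL u q) (par-opp d≢ _) = ⊥-elim (d≢ refl)
  diamond-bb (parL t p) (parL u q) (par-same i) with S , u′ , t′ ← diamond-bb t u i =
    _ , parL u′ q , parL t′ p
  diamond-bb (parR t p) (parR u q) (par-opp d≢ _) = ⊥-elim (d≢ refl)
  diamond-bb (parR t p) (parR u q) (par-same i) with S , u′ , t′ ← diamond-bb t u i =
    _ , parR u′ q , parR t′ p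
  diamond-bb (parL t p) (parR u q) i =
    _ , parR u (fresh-before t q) , parL t (fresh-before u p)
  diamond-bb (parR t p) (parL u q) i =
    _ , parL u (fresh-before t q) , parR t (fresh-before u p)
  diamond-bb (parL t p) (syn u v) (par-pair j) with S , u′ , t′ ← diamond-bb t u j =
    _ , syn u′ v , parL t′ (fresh-before v p)
  diamond-bb (parR t p) (syn v u) (par-pair j) with S , u′ , t′ ← diamond-bb t u j =
    _ , syn v u′ , parR t′ (fresh-before v p)
  diamond-bb (syn t v) (parL u q) (pair-par j) with S , u′ , t′ ← diamond-bb t u j =
    _ , parL u′ (fresh-before v q) , syn t′ v
  diamond-bb (syn v t) (parR u q) (pair-par j) with S , u′ , t′ ← diamond-bb t u j =
    _ , parR u′ (fresh-before v q) , syn v t′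
  diamond-bb (syn t v) (syn u w) (pair-pair i j)
    with S , u′ , t′ ← diamond-bb t u i | T , w′ , v′ ← diamond-bb v w j =
    _ , syn u′ w′ , syn t′ v′

  diamond : ∀ {P Q R θ θ′} d d′ → P.Step P (d , θ) Q → P.Step P (d′ , θ′) R → θ ⌣ θ′ →
            ∃[ S ] (P.Step Q (d′ , θ′) S × P.Step R (d , θ) S)
  diamond fwd fwd t u i = diamond-ff t u i
  diamond fwd bwd t u i = diamond-fb t u i
  -- The mixed case again, with the roles of the two steps exchanged.
  diamond bwd fwd t u i with S , t′ , u′ ← diamond-fb u t (⌣-sym i) = S , u′ , t′
  diamond bwd bwd t u i = diamond-bb t u i

  -- Backward steps from one process

  -- The process leaves little choice of rule. `act` against `pre`, or `sumL` against `sumR`, would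
  -- need a standard process that some step has just reached; different parallel rules would put the
  -- common key into a component where it must be fresh.
  backward-unique : ∀ {P Q R θ θ′} → Q —[ θ ]→ₚ P → R —[ θ′ ]→ₚ P →
                    key θ ≡ key θ′ → Q ≡ R × θ ≡ θ′
  backward-unique (act _) (act _) _ = refl , refl
  backward-unique (act std) (pre u _) _ = ⊥-elim (target-not-standard u std)
  backward-unique (pre t _) (act std) _ = ⊥-elim (target-not-standard t std)
  backward-unique (pre t _) (pre u _) e
    with refl , refl ← backward-unique t u e = refl , refl
  backward-unique (res t _ _) (res u _ _) e
    with refl , refl ← backward-unique t u e = refl , refl
  backward-unique (sumL t _) (sumL u _) e
    with refl , refl ← backward-unique t u e = refl , refl
  backward-unique (sumR t _) (sumR u _) e
    with refl , refl ← backward-unique t u e = refl , refl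
  backward-unique (sumL t std) (sumR u _) _ = ⊥-elim (target-not-standard u std)
  backward-unique (sumR t std) (sumL u _) _ = ⊥-elim (target-not-standard u std)
  backward-unique (parL t _) (parL u _) e
    with refl , refl ← backward-unique t u e = refl , refl
  backward-unique (parR t _) (parR u _) e
    with refl , refl ← backward-unique t u e = refl , refl
  backward-unique (parL t p) (parR u _) e = ⊥-elim (p (subst (_∈ _) (sym e) (key-added u)))
  backward-unique (parR t p) (parL u _) e = ⊥-elim (p (subst (_∈ _) (sym e) (key-added u)))
  backward-unique (parL t p) (syn {υR = υR} _ v) refl = ⊥-elim (p (key-added-syn υR v))
  backward-unique (parR t p) (syn {υL = υL} v _) refl = ⊥-elim (p (key-added-syn υL v))
  backward-unique (syn {υR = υR} _ v) (parL u q) refl = ⊥-elim (q (key-added-syn υR v))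
  backward-unique (syn {υL = υL} v _) (parR u q) refl = ⊥-elim (q (key-added-syn υL v))
  backward-unique (syn {υL = υL} {υR} t v) (syn {υL = υL′} {υR′} u w) refl
    with refl , e ← backward-unique t u (trans (key-⊳* υL) (sym (key-⊳* υL′)))
       | refl , e′ ← backward-unique v w (trans (key-⊳* υR) (sym (key-⊳* υR′)))
    -- The left half determines `υL` and the synchronised label, hence its complement; the right
    -- half has only `υR` left to supply.
    with refl , refl , _ ← ⊳*-injective υL υL′ e
       | refl , _ ← ⊳*-injective υR υR′ e′ = refl , refl

  -- The case analysis of `backward-unique`, except that different parallel rules are now possible.
  -- Steps on opposite sides are independent by their keys alone; a half of a synchronisation has
  -- the key of the pair, so induction applies to it.
  backward-independent : ∀ {P Q R θ θ′} → Q —[ θ ]→ₚ P → R —[ θ′ ]→ₚ P →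
                         key θ ≢ key θ′ → θ ⌣ θ′
  backward-independent (act _) (act _) k≢ = ⊥-elim (k≢ refl)
  backward-independent (act std) (pre u _) _ = ⊥-elim (target-not-standard u std)
  backward-independent (pre t _) (act std) _ = ⊥-elim (target-not-standard t std)
  backward-independent (pre t _) (pre u _) k≢ = backward-independent t u k≢
  backward-independent (res t _ _) (res u _ _) k≢ = backward-independent t u k≢
  backward-independent (sumL t _) (sumL u _) k≢ = sum (backward-independent t u k≢)
  backward-independent (sumR t _) (sumR u _) k≢ = sum (backward-independent t u k≢)
  backward-independent (sumL t std) (sumR u _) _ = ⊥-elim (target-not-standard u std)
  backward-independent (sumR t std) (sumL u _) _ = ⊥-elim (target-not-standard u std)
  backward-independent (parL t _) (parL u _) k≢ = par-same (backward-independent t u k≢)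
  backward-independent (parR t _) (parR u _) k≢ = par-same (backward-independent t u k≢)
  backward-independent (parL t _) (parR u _) k≢ = par-opp (λ ()) k≢
  backward-independent (parR t _) (parL u _) k≢ = par-opp (λ ()) k≢
  backward-independent (parL t _) (syn {υL = υL} u _) k≢ =
    par-pair (backward-independent t u (λ e → k≢ (trans e (key-⊳* υL))))
  backward-independent (parR t _) (syn {υR = υR} _ u) k≢ =
    par-pair (backward-independent t u (λ e → k≢ (trans e (key-⊳* υR))))
  backward-independent (syn {υL = υL} t _) (parL u _) k≢ =
    pair-par (backward-independent t u (λ e → k≢ (trans (sym (key-⊳* υL)) e)))
  backward-independent (syn {υR = υR} _ t) (parR u _) k≢ =
    pair-par (backward-independent t u (λ e → k≢ (trans (sym (key-⊳* υR)) e)))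
  backward-independent (syn {υL = υL} {υR} t v) (syn {υL = υL′} {υR′} u w) k≢ =
    pair-pair
      (backward-independent t u (λ e → k≢ (trans (sym (key-⊳* υL)) (trans e (key-⊳* υL′)))))
      (backward-independent v w (λ e → k≢ (trans (sym (key-⊳* υR)) (trans e (key-⊳* υR′)))))

  -- Undoing t₂ and t₁ from T in either order gives a second bottom corner, which
  -- must be B with the labels of b₁ and b₂.
  forward-square-labels : ∀ {B X Y T θ₁ θ₂ θ₁′ θ₂′} →
    B —[ θ₁ ]→ₚ X → B —[ θ₂ ]→ₚ Y → X —[ θ₂′ ]→ₚ T → Y —[ θ₁′ ]→ₚ T →
    key θ₁ ≡ key θ₁′ → key θ₂ ≡ key θ₂′ → key θ₁ ≢ key θ₂ → θ₁ ≡ θ₁′ × θ₂ ≡ θ₂′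
  forward-square-labels b₁ b₂ t₂ t₁ e₁ e₂ k≢
    with _ , b₁′ , b₂′ ← diamond-bb t₂ t₁
           (backward-independent t₂ t₁ (λ e → k≢ (trans e₁ (trans (sym e) (sym e₂))))) =
    proj₂ (backward-unique b₁ b₁′ e₁) , proj₂ (backward-unique b₂ b₂′ e₂)

  -- Every square becomes a forward one once its edges are reoriented. Its bottom corner is `P`,
  -- `R`, `Q` or `S` in the four cases, in this order.
  square-labels : ∀ {P Q R S θ₁ θ₂ θ₁′ θ₂′} d d′ →
    P.Step P (d , θ₁) Q → P.Step P (d′ , θ₂) R →
    P.Step Q (d′ , θ₂′) S → P.Step R (d , θ₁′) S →
    key θ₁ ≡ key θ₁′ → key θ₂ ≡ key θ₂′ → key θ₁ ≢ key θ₂ → θ₁ ≡ θ₁′ × θ₂ ≡ θ₂′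
  square-labels fwd fwd t u u′ t′ e₁ e₂ k≢ = forward-square-labels t u u′ t′ e₁ e₂ k≢
  square-labels fwd bwd t u u′ t′ e₁ e₂ k≢
    with refl , refl ← forward-square-labels t′ u u′ t (sym e₁) e₂
                         (λ e → k≢ (trans e₁ e)) = refl , refl
  square-labels bwd fwd t u u′ t′ e₁ e₂ k≢
    with refl , refl ← forward-square-labels t u′ u t′ e₁ (sym e₂)
                         (λ e → k≢ (trans e (sym e₂))) = refl , refl
  square-labels bwd bwd t u u′ t′ e₁ e₂ k≢
    with refl , refl ← forward-square-labels t′ u′ u t (sym e₁) (sym e₂)
                         (λ e → k≢ (trans e₁ (trans e (sym e₂)))) = refl , refl

  -- Erasure of proof labels

  erase-label : ProofLabel → Act × Key
  erase-label θ = action θ , key θ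

  erase-⊳* : ∀ υ {α k} → erase-label (υ ⊳* act α k) ≡ (α , k)
  erase-⊳* []      = refl
  erase-⊳* (s ∷ υ) = erase-⊳* υ

  erase : ∀ {X θ X′} → X —[ θ ]→ₚ X′ → X —[ erase-label θ ]→ X′
  erase (act std)    = act std
  erase (pre t k≢)   = pre (erase t) k≢
  erase (res t p q)  = res (erase t) p q
  erase (parL t k∉)  = parL (erase t) k∉
  erase (parR t k∉)  = parR (erase t) k∉
  erase (syn {υL = υL} {υR} t u) =
    syn (subst (λ a → _ —[ a ]→ _) (erase-⊳* υL) (erase t))
        (subst (λ a → _ —[ a ]→ _) (erase-⊳* υR) (erase u))
  erase (sumL t std) = sumL (erase t) std
  erase (sumR t std) = sumR (erase t) std

  erase-step : ∀ {X θ X′} d → P.Step X (d , θ) X′ → K.Step X (d , erase-label θ) X′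
  erase-step fwd s = erase s
  erase-step bwd s = erase s

  proof-label : ∀ t → ∃[ θ ] HasProofLabel t θ
  proof-label (K.transition _ (fwd , _) _ _ s) with θ , s′ , refl , refl ← lift s = θ , s′ , refl
  proof-label (K.transition _ (bwd , _) _ _ s) with θ , s′ , refl , refl ← lift s = θ , s′ , refl

  -- Both directions rest on the same forward step; the split only lets `flip-dir` and `Step`
  -- compute.
  inverse-HasProofLabel : ∀ t {θ} → HasProofLabel t θ → HasProofLabel (K.inverse t) θ
  inverse-HasProofLabel (K.transition _ (fwd , _) _ _ _) h = h
  inverse-HasProofLabel (K.transition _ (bwd , _) _ _ _) h = h

  -- Equal erased labels give opposite sides equal keys, and `θ ⌣ θ′` gives adjacent sides different
  -- ones. So `square-labels` identifies whatever proof labels the far sides have with `θ` and `θ′`.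
  square-HasProofLabel : ∀ {t u u′ t′ θ θ′} → Square CCSK t u u′ t′ →
    HasProofLabel t θ → HasProofLabel u θ′ → θ ⌣ θ′ → HasProofLabel t′ θ × HasProofLabel u′ θ′
  square-HasProofLabel {K.transition _ (d , _) _ _ _} {K.transition _ (d′ , _) _ _ _} {u′} {t′}
    record { coinitial = refl ; t-then-u′ = refl ; u-then-t′ = refl
           ; cofinal = refl ; same-lab-t = refl ; same-lab-u = refl }
    (s , refl) (r , refl) i
    with proof-label t′ | proof-label u′
  ... | _ , s′ , e | _ , r′ , e′
    with refl , refl ← square-labels d d′ s r r′ s′
           (sym (cong proj₂ e)) (sym (cong proj₂ e′)) (⌣⇒key≢ i) = (s′ , refl) , (r′ , refl)

  -- Serves IRE for CCSK, where equality of the erased labels would not determine independence.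
  EventEquiv-proof-label : ∀ {t t′} → EventEquiv CCSK t t′ →
                           ∃[ θ ] (HasProofLabel t θ × HasProofLabel t′ θ)
  EventEquiv-proof-label (square sq (_ , θ , _ , h , h′ , i)) =
    θ , h , proj₁ (square-HasProofLabel sq h h′ i)
  EventEquiv-proof-label {t} (~-refl (refl , refl , refl)) with θ , h ← proof-label t = θ , h , h
  EventEquiv-proof-label (~-sym e) with θ , h , h′ ← EventEquiv-proof-label e = θ , h′ , h
  EventEquiv-proof-label (~-trans {t′ = t′} e e′)
    with θ , h , h₁ ← EventEquiv-proof-label e | _ , h₂ , h′ ← EventEquiv-proof-label e′
    -- Each equivalence brings its own proof label for the middle transition; uniqueness makes them
    -- agree.
    with refl ← HasProofLabel-unique t′ h₁ h₂ = θ , h , h′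

  -- The axioms

  CCSKP-SP : SP CCSKP
  CCSKP-SP t u refl (_ , i) =
    complete-square CCSKP t u refl (diamond (P.dir t) (P.dir u) (P.step t) (P.step u) i)

  -- Deciding equality of the two keys separates the cases: different keys give independence, equal
  -- keys make the transitions coincide.
  CCSKP-BTI : DecidableEquality Key → BTI CCSKP
  CCSKP-BTI _≟_ t@(P.transition _ (bwd , θ) _ _ s) u@(P.transition _ (bwd , θ′) _ _ r)
    refl refl refl t≢u with key θ ≟ key θ′
  ... | no k≢ = coinitial⇒Connected CCSKP t u refl , backward-independent s r k≢
  ... | yes e with refl , refl ← backward-unique s r e = ⊥-elim (t≢u (refl , refl , refl))

  CCSKP-WF : WF CCSKP
  CCSKP-WF = measure⇒WF CCSKP (λ X → length (keys X)) length-keys-<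

  CCSKP-PCI : PCI CCSKP
  CCSKP-PCI t u u′ t′ sq (_ , i) =
    square-Connected CCSKP sq ,
    subst (_⌣ P.label t) (sym (cong proj₂ (Square.same-lab-u sq))) (⌣-sym i)

  CCSKP-IRE : IRE CCSKP
  CCSKP-IRE t t′ u e (c , i) =
    EventEquiv-Path CCSKP e ◅◅ c ,
    subst (_⌣ P.label u) (sym (cong proj₂ (EventEquiv-lab CCSKP e))) i

  -- Inverting changes the direction but not the proof label, so `i` is reused unchanged and only
  -- the path grows.
  CCSKP-RPI : RPI CCSKP
  CCSKP-RPI t t′ (c , i) = inverse-Connected CCSKP t t′ c , i

  CCSK-SP : SP CCSK
  CCSK-SP t u refl (_ , _ , _ , (s , refl) , (r , refl) , i)
    -- The square is completed among the corresponding proof-labelled steps and then erased.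
    with S , r′ , s′ ← diamond (K.dir t) (K.dir u) s r i =
    complete-square CCSK t u refl (S , erase-step (K.dir u) r′ , erase-step (K.dir t) s′)

  CCSK-BTI : DecidableEquality Key → BTI CCSK
  CCSK-BTI _≟_ t@(K.transition _ (bwd , _) _ _ _) u@(K.transition _ (bwd , _) _ _ _)
    refl refl refl t≢u with proof-label t | proof-label u
  ... | θ , s , refl | θ′ , r , refl with key θ ≟ key θ′
  ... | no k≢ = coinitial⇒Connected CCSK t u refl ,
                θ , θ′ , (s , refl) , (r , refl) , backward-independent s r k≢
  ... | yes e with refl , refl ← backward-unique s r e = ⊥-elim (t≢u (refl , refl , refl))

  CCSK-WF : WF CCSK
  CCSK-WF = measure⇒WF CCSK (λ X → length (keys X)) (λ s → length-keys-< (proj₁ (proj₂ (lift s))))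

  CCSK-PCI : PCI CCSK
  CCSK-PCI t u u′ t′ sq (_ , θ , θ′ , h , h′ , i) =
    square-Connected CCSK sq ,
    θ′ , θ , proj₂ (square-HasProofLabel sq h h′ i) , inverse-HasProofLabel t h , ⌣-sym i

  CCSK-IRE : IRE CCSK
  CCSK-IRE t t′ u e (c , θ , θ′ , h , h′ , i) with _ , k , k′ ← EventEquiv-proof-label e
    -- The proof label of `t′` in the independence is the one it shares with `t`.
    with refl ← HasProofLabel-unique t′ h k′ =
    EventEquiv-Path CCSK e ◅◅ c , θ , θ′ , k , h′ , i

  CCSK-RPI : RPI CCSK
  CCSK-RPI t t′ (c , θ , θ′ , h , h′ , i) =
    inverse-Connected CCSK t t′ c , θ , θ′ , inverse-HasProofLabel t h , h′ , i

theorem6p1 : (Name Key : Set) → DecidableEquality Key →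
    let open Calculus Name Key in
    (SP CCSKP × BTI CCSKP × WF CCSKP × PCI CCSKP × IRE CCSKP × RPI CCSKP) ×
    (SP CCSK × BTI CCSK × WF CCSK × PCI CCSK × IRE CCSK × RPI CCSK)
theorem6p1 Name Key _≟_ =
  (CCSKP-SP , CCSKP-BTI _≟_ , CCSKP-WF , CCSKP-PCI , CCSKP-IRE , CCSKP-RPI) ,
  (CCSK-SP , CCSK-BTI _≟_ , CCSK-WF , CCSK-PCI , CCSK-IRE , CCSK-RPI)
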